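{- Let $U$ be a nonempty set. For every MSO formula $\varphi$, the following are equivalent: (i) $\models^{d'}\varphi$ (standard validity over $U$); (ii) for every interpretation $II$ over $U$ and all assignments $gg:V\to U$, $GG:V_2\to\mathcal P(U)$ such that $\langle II,\mathrm{Range}(gg),\mathrm{Range}(GG)\rangle\subseteq_{E}\langle II,U,\mathcal P(U)\rangle$ (elementary substructure of the full model), the proposition $(\!|\varphi|\!)_{II,gg,GG}$ is true.
   Context: **Syntax.** Relation symbols $R=\mathbb N$, first-order variables $V=\mathbb N$ and second-order (monadic) variables $V_2=\mathbb N$ (the two kinds of variables form separate namespaces). MSO formulas: $\varphi,\psi ::= r(x,y)\mid X(x)\mid\neg\varphi\mid\varphi\wedge\psi\mid\exists x.\varphi\mid\exists X.\varphi$ with $r\in R$, $x,y\in V$, $X\in V_2$ (no equality). **Semantics.** $U$ is a fixed nonempty set (the type of individuals). An interpretation $I$ over $U$ assigns to each $r\in R$ a binary relation $I(r)\subseteq U\times U$. Given $I$, a set $D\subseteq U$, a family $E\subseteq\mathcal P(U)$ (no closure condition on $E$), and assignments $g:V\to U$, $G:V_2\to\mathcal P(U)$, truth $\langle I,D,E\rangle,g,G\models^d\varphi$ is defined recursively: $r(x,y)$ holds iff $(g(x),g(y))\in I(r)$; $X(x)$ holds iff $g(x)\in G(X)$; $\neg,\wedge$ are classical; $\exists x.\varphi$ holds iff $\langle I,D,E\rangle,g[x\leftarrow d],G\models^d\varphi$ for some $d\in D$; $\exists X.\varphi$ holds iff $\langle I,D,E\rangle,g,G\langle X\leftarrow S\rangle\models^d\varphi$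 for some $S\in E$. Here $g[x\leftarrow d]$ and $G\langle X\leftarrow S\rangle$ are the usual updates. **Standard validity.** $\models^{d'}\varphi$ means: for all $I$, $g:V\to U$, $G:V_2\to\mathcal P(U)$, $\langle I,U,\mathcal P(U)\rangle,g,G\models^d\varphi$. **Elementary substructure.** $\langle I',D',E'\rangle\subseteq_E\langle I,D,E\rangle$ means: $D'\subseteq D$, $E'\subseteq E$, and for every formula $\psi$, every $g$ with $\mathrm{Range}(g)\subseteq D'$ and every $G$ with $\mathrm{Range}(G)\subseteq E'$, $\langle I',D',E'\rangle,g,G\models^d\psi$ iff $\langle I,D,E\rangle,g,G\models^d\psi$. (The subscript $E$ in $\subseteq_E$ is just part of the notation.) **Safe substitution.** $[x\leftarrow_r z](\varphi)$ (for $x,z\in V$) is capture-avoiding substitution: first rename every binder $\exists z$ in $\varphi$, together with the occurrences it binds, to $\exists w$ for a fresh variable $w$ (say the least one not occurring in $\varphi$ and different from $x,z$), then replace all free occurrences of $x$ by $z$. $[X\leftarrow_{r2}Z](\varphi)$ for $X,Z\in V_2$ is the analogous operation for second-order variables. Binders of one namespace do not interact with substitution in the other. Both operations preserve formula size. **Minimal-shallow translation.** For parameters $II$ (an interpretation over $U$), $gg:V\to U$, $GG:V_2\to\mathcal P(U)$, the truth value $(\!|\varphi|\!)=(\!|\varphi|\!)_{II,gg,GG}$ is defined by recursion on formula size: $(\!|r(x,y)|\!)$ is $(gg(x),gg(y))\in II(r)$; $(\!|X(x)|\!)$ is $gg(x)\in GG(X)$; $(\!|\neg\varphi|\!)$ is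 $\neg(\!|\varphi|\!)$; $(\!|\varphi\wedge\psi|\!)$ is $(\!|\varphi|\!)\wedge(\!|\psi|\!)$; $(\!|\exists x.\varphi|\!)$ is "there is a variable $z\in V$ with $(\!|[x\leftarrow_r z](\varphi)|\!)$"; $(\!|\exists X.\varphi|\!)$ is "there is a variable $Z\in V_2$ with $(\!|[X\leftarrow_{r2}Z](\varphi)|\!)$". -}

module Defs where

open import Level using (Level; suc; Lift)
open import Data.Bool using (if_then_else_; true; false)
open import Data.List using (List; []; _∷_; _++_)
open import Data.List.Extrema.Nat using (max)
open import Data.List.Membership.DecPropositional using (_∈?_)
open import Data.Nat using (ℕ; zero; _+_; _≟_; _<_; s≤s) renaming (suc to 1+)
open import Data.Nat.Induction using (<-wellFounded)
open import Data.Nat.Properties using (n<1+n; m≤m+n; m≤n+m)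
open import Data.Product using (∃; _×_)
open import Function using (id)
open import Function.Bundles using (_⇔_)
open import Induction.WellFounded using (Acc; acc)
open import Relation.Binary using (Rel)
open import Relation.Binary.PropositionalEquality
  using (_≡_; refl; cong; cong₂; trans; sym; subst)
open import Relation.Nullary using (¬_; does)
open import Relation.Unary using (Pred; _∈_; _⊆_; _≐_)
open import Relation.Unary.Polymorphic using (U)

private
  variable
    a : Level

RelSym Var Var₂ : Set
RelSym = ℕ
Var    = ℕ
Var₂   = ℕ

data Formula : Set where
  rel  : (r : RelSym) (x y : Var) → Formula
  app  : (X : Var₂) (x : Var) → Formula
  neg  : (φ : Formula) → Formula
  conj : (φ ψ : Formula) → Formula
  ex   : (x : Var) (φ : Formula) → Formula
  ex₂  : (X : Var₂) (φ : Formula) → Formula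

infixl 10 _[_←_]

_[_←_] : {A : Set a} → (ℕ → A) → ℕ → A → ℕ → A
(f [ x ← v ]) y = if does (y ≟ x) then v else f y

Interpretation : Set a → Set (suc a)
Interpretation {a} A = RelSym → Rel A a

-- Subsets of A are predicates in `Pred A a`, identified up to `_≐_`.  Under
-- excluded middle the choice of level does not matter.
record Structure (A : Set a) : Set (suc a) where
  constructor ⟨_,_,_⟩
  field
    interp : Interpretation A
    dom    : Pred A a
    fam    : Pred (Pred A a) a

open Structure public

full : {A : Set a} → Interpretation A → Structure A
full I = ⟨ I , U , U ⟩

infix 4 _⊨[_,_]_

-- `Lift` only adjusts universe levels: ∃X ranges over the large type `Pred A a`.
_⊨[_,_]_ : {A : Set a} → Structure A → (Var → A) → (Var₂ → Pred A a) →
           Formula → Set (suc a)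
_⊨[_,_]_ {a} M g G (rel r x y) = Lift (suc a) (interp M r (g x) (g y))
_⊨[_,_]_ {a} M g G (app X x)   = Lift (suc a) (g x ∈ G X)
M ⊨[ g , G ] neg φ    = ¬ (M ⊨[ g , G ] φ)
M ⊨[ g , G ] conj φ ψ = (M ⊨[ g , G ] φ) × (M ⊨[ g , G ] ψ)
M ⊨[ g , G ] ex x φ   = ∃ λ d → d ∈ dom M × (M ⊨[ g [ x ← d ] , G ] φ)
M ⊨[ g , G ] ex₂ X φ  = ∃ λ S → S ∈ fam M × (M ⊨[ g , G [ X ← S ] ] φ)

Valid : Set a → Formula → Set (suc a)
Valid {a} A φ =
  (I : Interpretation A) (g : Var → A) (G : Var₂ → Pred A a) → full I ⊨[ g , G ] φ

Range : {A : Set a} → (Var → A) → Pred A a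
Range g d = ∃ λ x → g x ≡ d

Range₂ : {A : Set a} → (Var₂ → Pred A a) → Pred (Pred A a) a
Range₂ G S = ∃ λ X → G X ≐ S

infix 4 _⊆ᴱ_

_⊆ᴱ_ : {A : Set a} → Structure A → Structure A → Set (suc a)
_⊆ᴱ_ {a} {A} M N =
  dom M ⊆ dom N ×
  fam M ⊆ fam N ×
  ((ψ : Formula) (g : Var → A) (G : Var₂ → Pred A a) →
   Range g ⊆ dom M → Range₂ G ⊆ fam M →
   (M ⊨[ g , G ] ψ) ⇔ (N ⊨[ g , G ] ψ))

-- All variables occurring in a formula, as free, bound or binding occurrences.
vars vars₂ : Formula → List ℕ
vars (rel r x y) = x ∷ y ∷ []
vars (app X x)   = x ∷ []
vars (neg φ)     = vars φ
vars (conj φ ψ)  = vars φ ++ vars ψ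
vars (ex x φ)    = x ∷ vars φ
vars (ex₂ X φ)   = vars φ

vars₂ (rel r x y) = []
vars₂ (app X x)   = X ∷ []
vars₂ (neg φ)     = vars₂ φ
vars₂ (conj φ ψ)  = vars₂ φ ++ vars₂ ψ
vars₂ (ex x φ)    = vars₂ φ
vars₂ (ex₂ X φ)   = X ∷ vars₂ φ

-- `fresh xs` is the least number not in xs: the candidates 0, …, max xs are
-- tried in turn, and 1 + max xs is returned if all of them are in xs.
searchFrom : ℕ → ℕ → List ℕ → ℕ
searchFrom zero        n xs = n
searchFrom (1+ budget) n xs =
  if does (_∈?_ _≟_ n xs) then searchFrom budget (1+ n) xs else n

fresh : List ℕ → ℕ
fresh xs = searchFrom (1+ (max 0 xs)) 0 xs

-- Replacement of the free occurrences of x by z, without regard to capture.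
replace replace₂ : (x z : ℕ) → Formula → Formula
replace x z (rel r u v) = rel r ((id [ x ← z ]) u) ((id [ x ← z ]) v)
replace x z (app X u)   = app X ((id [ x ← z ]) u)
replace x z (neg φ)     = neg (replace x z φ)
replace x z (conj φ ψ)  = conj (replace x z φ) (replace x z ψ)
replace x z (ex u φ)    = ex u (if does (u ≟ x) then φ else replace x z φ)
replace x z (ex₂ X φ)   = ex₂ X (replace x z φ)

replace₂ X Z (rel r u v) = rel r u v
replace₂ X Z (app Y u)   = app ((id [ X ← Z ]) Y) u
replace₂ X Z (neg φ)     = neg (replace₂ X Z φ)
replace₂ X Z (conj φ ψ)  = conj (replace₂ X Z φ) (replace₂ X Z ψ)
replace₂ X Z (ex u φ)    = ex u (replace₂ X Z φ)
replace₂ X Z (ex₂ Y φ)   = ex₂ Y (if does (Y ≟ X) then φ else replace₂ X Z φ)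

-- Renaming of every binder ∃z, and the occurrences it binds, to w.  It is only
-- used with w not occurring in the formula; inner binders are renamed first,
-- so no free z is left below a binder ∃w when the outer ones are treated.
rename rename₂ : (z w : ℕ) → Formula → Formula
rename z w (rel r u v) = rel r u v
rename z w (app X u)   = app X u
rename z w (neg φ)     = neg (rename z w φ)
rename z w (conj φ ψ)  = conj (rename z w φ) (rename z w ψ)
rename z w (ex u φ)    = if does (u ≟ z) then ex w (replace z w (rename z w φ))
                                         else ex u (rename z w φ)
rename z w (ex₂ X φ)   = ex₂ X (rename z w φ)

rename₂ Z W (rel r u v) = rel r u v
rename₂ Z W (app X u)   = app X u
rename₂ Z W (neg φ)     = neg (rename₂ Z W φ)
rename₂ Z W (conj φ ψ)  = conj (rename₂ Z W φ) (rename₂ Z W ψ)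
rename₂ Z W (ex u φ)    = ex u (rename₂ Z W φ)
rename₂ Z W (ex₂ Y φ)   = if does (Y ≟ Z) then ex₂ W (replace₂ Z W (rename₂ Z W φ))
                                          else ex₂ Y (rename₂ Z W φ)

infix 5 [_←ᵣ_]_ [_←ᵣ₂_]_

[_←ᵣ_]_ : (x z : Var) → Formula → Formula
[ x ←ᵣ z ] φ = replace x z (rename z (fresh (x ∷ z ∷ vars φ)) φ)

[_←ᵣ₂_]_ : (X Z : Var₂) → Formula → Formula
[ X ←ᵣ₂ Z ] φ = replace₂ X Z (rename₂ Z (fresh (X ∷ Z ∷ vars₂ φ)) φ)

size : Formula → ℕ
size (rel r x y) = 1
size (app X x)   = 1
size (neg φ)     = 1+ (size φ)
size (conj φ ψ)  = 1+ (size φ + size ψ)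
size (ex x φ)    = 1+ (size φ)
size (ex₂ X φ)   = 1+ (size φ)

size-replace : ∀ x z φ → size (replace x z φ) ≡ size φ
size-replace x z (rel r u v) = refl
size-replace x z (app X u)   = refl
size-replace x z (neg φ)     = cong 1+ (size-replace x z φ)
size-replace x z (conj φ ψ)  =
  cong 1+ (cong₂ _+_ (size-replace x z φ) (size-replace x z ψ))
size-replace x z (ex u φ) with does (u ≟ x)
... | true  = refl
... | false = cong 1+ (size-replace x z φ)
size-replace x z (ex₂ X φ)   = cong 1+ (size-replace x z φ)

size-replace₂ : ∀ X Z φ → size (replace₂ X Z φ) ≡ size φ
size-replace₂ X Z (rel r u v) = refl
size-replace₂ X Z (app Y u)   = refl
size-replace₂ X Z (neg φ)     = cong 1+ (size-replace₂ X Z φ)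
size-replace₂ X Z (conj φ ψ)  =
  cong 1+ (cong₂ _+_ (size-replace₂ X Z φ) (size-replace₂ X Z ψ))
size-replace₂ X Z (ex u φ)    = cong 1+ (size-replace₂ X Z φ)
size-replace₂ X Z (ex₂ Y φ) with does (Y ≟ X)
... | true  = refl
... | false = cong 1+ (size-replace₂ X Z φ)

size-rename : ∀ z w φ → size (rename z w φ) ≡ size φ
size-rename z w (rel r u v) = refl
size-rename z w (app X u)   = refl
size-rename z w (neg φ)     = cong 1+ (size-rename z w φ)
size-rename z w (conj φ ψ)  =
  cong 1+ (cong₂ _+_ (size-rename z w φ) (size-rename z w ψ))
size-rename z w (ex u φ) with does (u ≟ z)
... | true  =
  cong 1+ (trans (size-replace z w (rename z w φ)) (size-rename z w φ))
... | false = cong 1+ (size-rename z w φ)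
size-rename z w (ex₂ X φ)   = cong 1+ (size-rename z w φ)

size-rename₂ : ∀ Z W φ → size (rename₂ Z W φ) ≡ size φ
size-rename₂ Z W (rel r u v) = refl
size-rename₂ Z W (app X u)   = refl
size-rename₂ Z W (neg φ)     = cong 1+ (size-rename₂ Z W φ)
size-rename₂ Z W (conj φ ψ)  =
  cong 1+ (cong₂ _+_ (size-rename₂ Z W φ) (size-rename₂ Z W ψ))
size-rename₂ Z W (ex u φ)    = cong 1+ (size-rename₂ Z W φ)
size-rename₂ Z W (ex₂ Y φ) with does (Y ≟ Z)
... | true  =
  cong 1+ (trans (size-replace₂ Z W (rename₂ Z W φ)) (size-rename₂ Z W φ))
... | false = cong 1+ (size-rename₂ Z W φ)

size-[←ᵣ] : ∀ x z φ → size ([ x ←ᵣ z ] φ) ≡ size φ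
size-[←ᵣ] x z φ = trans (size-replace x z _) (size-rename z _ φ)

size-[←ᵣ₂] : ∀ X Z φ → size ([ X ←ᵣ₂ Z ] φ) ≡ size φ
size-[←ᵣ₂] X Z φ = trans (size-replace₂ X Z _) (size-rename₂ Z _ φ)

module _ {A : Set a} (II : Interpretation A) (gg : Var → A) (GG : Var₂ → Pred A a) where

  shallow : (φ : Formula) → Acc _<_ (size φ) → Set a
  shallow (rel r x y) _        = II r (gg x) (gg y)
  shallow (app X x)   _        = gg x ∈ GG X
  shallow (neg φ)     (acc rs) = ¬ shallow φ (rs (n<1+n _))
  shallow (conj φ ψ)  (acc rs) = shallow φ (rs (s≤s (m≤m+n _ _))) ×
                                 shallow ψ (rs (s≤s (m≤n+m _ _)))
  shallow (ex x φ)    (acc rs) = ∃ λ z → shallow ([ x ←ᵣ z ] φ)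
    (rs (subst (_< 1+ (size φ)) (sym (size-[←ᵣ] x z φ)) (n<1+n _)))
  shallow (ex₂ X φ)   (acc rs) = ∃ λ Z → shallow ([ X ←ᵣ₂ Z ] φ)
    (rs (subst (_< 1+ (size φ)) (sym (size-[←ᵣ₂] X Z φ)) (n<1+n _)))

-- `⦅ φ ⦆ II gg GG` is the minimal-shallow translation of φ.
⦅_⦆ : {A : Set a} → Formula → Interpretation A → (Var → A) → (Var₂ → Pred A a) → Set a
⦅ φ ⦆ II gg GG = shallow II gg GG φ (<-wellFounded (size φ))

{-# OPTIONS --safe #-}
module Submission where

-- The translation ⦅_⦆ is truth in the structure of named elements, whose domain and
-- family are the ranges of gg and GG, since substituting z for x amounts to updating x
-- to gg z.  So validity implies (ii) by elementarity.  Conversely, a falsifying I, g, G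
-- is refuted through a Löwenheim–Skolem construction: only the variables below some n
-- occur in φ, gg and GG agree with g and G there, and variable k + n is made to name a
-- witness for the k-th existential statement about earlier variables.  By the
-- Tarski–Vaught test the named elements then form an elementary substructure.

open import Defs
open import Level using (Level; suc; lift; lower)
open import Axiom.ExcludedMiddle using (ExcludedMiddle)
open import Data.Bool using (true; false)
open import Data.List using (_∷_; map)
open import Data.List.Extrema.Nat using (max; xs≤max)
open import Data.List.Membership.DecPropositional using (_∈?_)
open import Data.List.Membership.Propositional using () renaming (_∈_ to _∈ˡ_; _∉_ to _∉ˡ_)
open import Data.List.Membership.Propositional.Properties using (∈-++⁺ˡ; ∈-++⁺ʳ; ∈-map⁺)
open import Data.List.Relation.Unary.All as All using ()
open import Data.List.Relation.Unary.Any using (here; there)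
open import Data.Nat using (ℕ; zero; _+_; _≤_; _<_; _≟_; s≤s; s≤s⁻¹) renaming (suc to 1+)
open import Data.Nat.Properties
open import Data.Product using (∃; _×_; _,_; proj₁; proj₂; ∃-syntax; map₂)
open import Data.Product.Function.NonDependent.Propositional using (_×-⇔_)
open import Data.Unit using (⊤; tt)
open import Function using (id; _∘_)
open import Function.Bundles using (_⇔_; mk⇔; Equivalence)
open import Function.Construct.Composition using (_⇔-∘_)
open import Function.Construct.Identity using (⇔-id)
open import Function.Construct.Symmetry using (⇔-sym)
open import Function.Properties.Equivalence using (⇔-setoid)
open import Function.Related.TypeIsomorphisms using (¬-cong-⇔)
open import Induction.WellFounded using (Acc; acc)
open import Relation.Binary using (Rel)
open import Relation.Binary.PropositionalEquality
  using (_≡_; _≢_; _≗_; refl; cong; cong₂; trans; sym; subst; ≢-sym; module ≡-Reasoning)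
open import Relation.Nullary using (Dec; does; yes; no; contradiction)
open import Relation.Nullary.Decidable using (dec-true; dec-false)
open import Relation.Unary using (Pred; _∈_; _≐_)
open import Relation.Unary.Properties using (≐-refl; ≐-sym)
import Relation.Binary.Reasoning.Setoid as SetoidReasoning

open Equivalence using (to; from)

private
  variable
    a b ℓ : Level
    A B : Set a
    x y z w n : ℕ

-- Function update

update-same : (f : ℕ → A) (x : ℕ) (v : A) → (f [ x ← v ]) x ≡ v
update-same f x v rewrite dec-true (x ≟ x) refl = refl

update-other : (f : ℕ → A) (v : A) → y ≢ x → (f [ x ← v ]) y ≡ f y
update-other {y = y} {x} f v y≢x rewrite dec-false (y ≟ x) y≢x = refl

-- The relation is a parameter because individuals are compared by `_≡_` and sets by `_≐_`.
-- Agreement is asked only at `y`, which suits assignments that agree just on the variables of a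
-- formula.
update-cong : (_~_ : Rel A ℓ) (f f′ : ℕ → A) {v v′ : A} →
  ∀ x → v ~ v′ → ∀ y → f y ~ f′ y → (f [ x ← v ]) y ~ (f′ [ x ← v′ ]) y
update-cong _~_ f f′ x v~v′ y fy~f′y with does (y ≟ x)
... | true  = v~v′
... | false = fy~f′y

update-swap : (f : ℕ → A) (v v′ : A) → x ≢ z →
  f [ x ← v ] [ z ← v′ ] ≗ f [ z ← v′ ] [ x ← v ]
update-swap {x = x} {z} f v v′ x≢z y with y ≟ x
... | no y≢x rewrite dec-false (y ≟ x) y≢x = refl
... | yes refl rewrite dec-true (y ≟ y) refl | dec-false (y ≟ z) x≢z = refl

update-overwrite : (f : ℕ → A) (x : ℕ) (v v′ : A) → f [ x ← v ] [ x ← v′ ] ≗ f [ x ← v′ ]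
update-overwrite f x v v′ y with does (y ≟ x)
... | true  = refl
... | false = refl

update-∘ : (h : A → B) (f : ℕ → A) (x : ℕ) (v : A) → h ∘ f [ x ← v ] ≗ (h ∘ f) [ x ← h v ]
update-∘ h f x v y with does (y ≟ x)
... | true  = refl
... | false = refl

-- Serves the renaming of a binder `∃z` to `∃w`: the value bound to `w` is passed on to `z`, and
-- only `w` itself could tell the difference.
update-via : (f : ℕ → A) (z : ℕ) (v : A) → y ≢ w →
  (f [ w ← v ] [ z ← (f [ w ← v ]) w ]) y ≡ (f [ z ← v ]) y
update-via {y = y} {w = w} f z v y≢w =
  update-cong _≡_ (f [ w ← v ]) f z (update-same f w v) y (update-other f v y≢w)

-- Freshness

∈⇒≤max : ∀ xs → x ∈ˡ xs → x ≤ max 0 xs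
∈⇒≤max xs = All.lookup (xs≤max 0 xs)

-- The sum `budget + n` is invariant, so once the budget is spent `n` exceeds every element of the
-- list.
searchFrom-∉ : ∀ budget n xs → max 0 xs < budget + n → searchFrom budget n xs ∉ˡ xs
searchFrom-∉ zero n xs max<n n∈xs = <⇒≱ max<n (∈⇒≤max xs n∈xs)
searchFrom-∉ (1+ budget) n xs max<b+n with _∈?_ _≟_ n xs
... | yes _ = searchFrom-∉ budget (1+ n) xs (subst (max 0 xs <_) (sym (+-suc budget n)) max<b+n)
... | no n∉xs = n∉xs

fresh-∉ : ∀ xs → fresh xs ∉ˡ xs
fresh-∉ xs = searchFrom-∉ (1+ (max 0 xs)) 0 xs (m≤m+n _ 0)

-- Coincidence

∃-cong : {P Q : Pred A ℓ} {D : Pred A b} → (∀ d → P d ⇔ Q d) →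
  (∃ λ d → d ∈ D × P d) ⇔ (∃ λ d → d ∈ D × Q d)
∃-cong P⇔Q = mk⇔ (map₂ (map₂ (to (P⇔Q _)))) (map₂ (map₂ (from (P⇔Q _))))

module _ {A : Set a} (M : Structure A) where

  private
    variable
      g g′ : Var → A
      G G′ : Var₂ → Pred A a

  -- Agreement is required on bound variables too, so the hypothesis restricts to the body of a
  -- quantifier by `there` alone.
  ⊨-coincide : ∀ φ → (∀ x → x ∈ˡ vars φ → g x ≡ g′ x) → (∀ X → X ∈ˡ vars₂ φ → G X ≐ G′ X) →
    (M ⊨[ g , G ] φ) ⇔ (M ⊨[ g′ , G′ ] φ)
  ⊨-coincide (rel r x y) g≈ G≈ rewrite g≈ x (here refl) | g≈ y (there (here refl)) = ⇔-id _
  ⊨-coincide (app X x) g≈ G≈ rewrite g≈ x (here refl) =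
    mk⇔ (λ (lift p) → lift (proj₁ (G≈ X (here refl)) p))
        (λ (lift p) → lift (proj₂ (G≈ X (here refl)) p))
  ⊨-coincide (neg φ) g≈ G≈ = ¬-cong-⇔ (⊨-coincide φ g≈ G≈)
  ⊨-coincide (conj φ ψ) g≈ G≈ =
    ⊨-coincide φ (λ x → g≈ x ∘ ∈-++⁺ˡ) (λ X → G≈ X ∘ ∈-++⁺ˡ) ×-⇔
    ⊨-coincide ψ (λ x → g≈ x ∘ ∈-++⁺ʳ (vars φ)) (λ X → G≈ X ∘ ∈-++⁺ʳ (vars₂ φ))
  ⊨-coincide {g} {g′} (ex x φ) g≈ G≈ = ∃-cong λ d →
    ⊨-coincide φ (λ y y∈ → update-cong _≡_ g g′ x refl y (g≈ y (there y∈))) G≈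
  ⊨-coincide {G = G} {G′} (ex₂ X φ) g≈ G≈ = ∃-cong λ S →
    ⊨-coincide φ g≈ (λ Y Y∈ → update-cong _≐_ G G′ X (≐-refl {x = S}) Y (G≈ Y (there Y∈)))

  ⊨-cong : ∀ φ → g ≗ g′ → (∀ X → G X ≐ G′ X) → (M ⊨[ g , G ] φ) ⇔ (M ⊨[ g′ , G′ ] φ)
  ⊨-cong φ g≗ G≐ = ⊨-coincide φ (λ x _ → g≗ x) (λ X _ → G≐ X)

-- Substitution

-- A sufficient condition for `replace x z` to capture nothing.
NoBinder NoBinder₂ : ℕ → Formula → Set
NoBinder z (rel r x y) = ⊤
NoBinder z (app X x)   = ⊤
NoBinder z (neg φ)     = NoBinder z φ
NoBinder z (conj φ ψ)  = NoBinder z φ × NoBinder z ψ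
NoBinder z (ex x φ)    = x ≢ z × NoBinder z φ
NoBinder z (ex₂ X φ)   = NoBinder z φ

NoBinder₂ Z (rel r x y) = ⊤
NoBinder₂ Z (app X x)   = ⊤
NoBinder₂ Z (neg φ)     = NoBinder₂ Z φ
NoBinder₂ Z (conj φ ψ)  = NoBinder₂ Z φ × NoBinder₂ Z ψ
NoBinder₂ Z (ex x φ)    = NoBinder₂ Z φ
NoBinder₂ Z (ex₂ X φ)   = X ≢ Z × NoBinder₂ Z φ

NoBinder-replace : ∀ φ → NoBinder z φ → NoBinder z (replace x y φ)
NoBinder-replace (rel r u v) nb = tt
NoBinder-replace (app X u) nb = tt
NoBinder-replace (neg φ) nb = NoBinder-replace φ nb
NoBinder-replace (conj φ ψ) (nb , nb′) = NoBinder-replace φ nb , NoBinder-replace ψ nb′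
NoBinder-replace {x = x} (ex u φ) (u≢z , nb) with does (u ≟ x)
... | true = u≢z , nb
... | false  = u≢z , NoBinder-replace φ nb
NoBinder-replace (ex₂ X φ) nb = NoBinder-replace φ nb

NoBinder₂-replace₂ : ∀ φ → NoBinder₂ z φ → NoBinder₂ z (replace₂ x y φ)
NoBinder₂-replace₂ (rel r u v) nb = tt
NoBinder₂-replace₂ (app X u) nb = tt
NoBinder₂-replace₂ (neg φ) nb = NoBinder₂-replace₂ φ nb
NoBinder₂-replace₂ (conj φ ψ) (nb , nb′) = NoBinder₂-replace₂ φ nb , NoBinder₂-replace₂ ψ nb′
NoBinder₂-replace₂ (ex u φ) nb = NoBinder₂-replace₂ φ nb
NoBinder₂-replace₂ {x = x} (ex₂ X φ) (X≢z , nb) with does (X ≟ x)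
... | true = X≢z , nb
... | false  = X≢z , NoBinder₂-replace₂ φ nb

NoBinder-rename : w ≢ z → ∀ φ → NoBinder z (rename z w φ)
NoBinder-rename w≢z (rel r x y) = tt
NoBinder-rename w≢z (app X x) = tt
NoBinder-rename w≢z (neg φ) = NoBinder-rename w≢z φ
NoBinder-rename w≢z (conj φ ψ) = NoBinder-rename w≢z φ , NoBinder-rename w≢z ψ
NoBinder-rename {z = z} w≢z (ex x φ) with x ≟ z
... | yes x≡z rewrite dec-true (x ≟ z) x≡z = w≢z , NoBinder-replace (rename z _ φ) (NoBinder-rename w≢z φ)
... | no x≢z rewrite dec-false (x ≟ z) x≢z = x≢z , NoBinder-rename w≢z φ
NoBinder-rename w≢z (ex₂ X φ) = NoBinder-rename w≢z φ

NoBinder₂-rename₂ : w ≢ z → ∀ φ → NoBinder₂ z (rename₂ z w φ)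
NoBinder₂-rename₂ w≢z (rel r x y) = tt
NoBinder₂-rename₂ w≢z (app X x) = tt
NoBinder₂-rename₂ w≢z (neg φ) = NoBinder₂-rename₂ w≢z φ
NoBinder₂-rename₂ w≢z (conj φ ψ) = NoBinder₂-rename₂ w≢z φ , NoBinder₂-rename₂ w≢z ψ
NoBinder₂-rename₂ w≢z (ex x φ) = NoBinder₂-rename₂ w≢z φ
NoBinder₂-rename₂ {z = z} w≢z (ex₂ X φ) with X ≟ z
... | yes X≡z rewrite dec-true (X ≟ z) X≡z = w≢z , NoBinder₂-replace₂ (rename₂ z _ φ) (NoBinder₂-rename₂ w≢z φ)
... | no X≢z rewrite dec-false (X ≟ z) X≢z = X≢z , NoBinder₂-rename₂ w≢z φ

id[←]-idem : z ≢ x → ∀ y → (id [ x ← z ]) ((id [ x ← z ]) y) ≡ (id [ x ← z ]) y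
id[←]-idem {z} {x} z≢x y with y ≟ x
... | yes refl rewrite dec-true (y ≟ y) refl = update-other id z z≢x
... | no y≢x rewrite dec-false (y ≟ x) y≢x = update-other id z y≢x

-- The first pass leaves no free `x`, because the inserted `z` differs from `x`.
replace-idem : z ≢ x → ∀ φ → replace x z (replace x z φ) ≡ replace x z φ
replace-idem z≢x (rel r u v) = cong₂ (rel r) (id[←]-idem z≢x u) (id[←]-idem z≢x v)
replace-idem z≢x (app X u) = cong (app X) (id[←]-idem z≢x u)
replace-idem z≢x (neg φ) = cong neg (replace-idem z≢x φ)
replace-idem z≢x (conj φ ψ) = cong₂ conj (replace-idem z≢x φ) (replace-idem z≢x ψ)
replace-idem {x = x} z≢x (ex u φ) with u ≟ x
... | yes u≡x rewrite dec-true (u ≟ x) u≡x = refl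
... | no u≢x rewrite dec-false (u ≟ x) u≢x = cong (ex u) (replace-idem z≢x φ)
replace-idem z≢x (ex₂ X φ) = cong (ex₂ X) (replace-idem z≢x φ)

replace₂-idem : z ≢ x → ∀ φ → replace₂ x z (replace₂ x z φ) ≡ replace₂ x z φ
replace₂-idem z≢x (rel r u v) = refl
replace₂-idem z≢x (app X u) = cong (λ Y → app Y u) (id[←]-idem z≢x X)
replace₂-idem z≢x (neg φ) = cong neg (replace₂-idem z≢x φ)
replace₂-idem z≢x (conj φ ψ) = cong₂ conj (replace₂-idem z≢x φ) (replace₂-idem z≢x ψ)
replace₂-idem z≢x (ex u φ) = cong (ex u) (replace₂-idem z≢x φ)
replace₂-idem {x = x} z≢x (ex₂ X φ) with X ≟ x
... | yes X≡x rewrite dec-true (X ≟ x) X≡x = refl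
... | no X≢x rewrite dec-false (X ≟ x) X≢x = cong (ex₂ X) (replace₂-idem z≢x φ)

-- Truth under substitution and renaming

≐-reflexive : {P Q : Pred A ℓ} → P ≡ Q → P ≐ Q
≐-reflexive refl = ≐-refl

module _ {A : Set a} (M : Structure A) where

  private
    variable
      g g′ : Var → A
      G G′ : Var₂ → Pred A a

  open SetoidReasoning (⇔-setoid (suc a))

  ⊨-cong₁ : ∀ φ → g ≗ g′ → (M ⊨[ g , G ] φ) ⇔ (M ⊨[ g′ , G ] φ)
  ⊨-cong₁ φ g≗ = ⊨-cong M φ g≗ (λ _ → ≐-refl)

  ⊨-cong₂ : ∀ φ → G ≗ G′ → (M ⊨[ g , G ] φ) ⇔ (M ⊨[ g , G′ ] φ)
  ⊨-cong₂ φ G≗ = ⊨-cong M φ (λ _ → refl) (λ X → ≐-reflexive (G≗ X))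

  -- No binder changes the value of `z`, so every inserted `z` still denotes `g z`.
  replace-⊨ : ∀ φ → NoBinder z φ →
    (M ⊨[ g , G ] replace x z φ) ⇔ (M ⊨[ g [ x ← g z ] , G ] φ)
  replace-⊨ {z} {g} {x = x} (rel r u v) nb
    rewrite update-∘ g id x z u | update-∘ g id x z v = ⇔-id _
  replace-⊨ {z} {g} {x = x} (app X u) nb
    rewrite update-∘ g id x z u = ⇔-id _
  replace-⊨ (neg φ) nb = ¬-cong-⇔ (replace-⊨ φ nb)
  replace-⊨ (conj φ ψ) (nb , nb′) = replace-⊨ φ nb ×-⇔ replace-⊨ ψ nb′
  replace-⊨ {z} {g} {G} {x = x} (ex u φ) (u≢z , nb) with u ≟ x
  -- The binder shadows `x`: replacement stops here, and the quantified value overwrites the update.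
  ... | yes refl rewrite dec-true (u ≟ u) refl = ∃-cong λ d → ⊨-cong₁ φ (sym ∘ update-overwrite g u (g z) d)
  ... | no u≢x rewrite dec-false (u ≟ x) u≢x = ∃-cong λ d → begin
    M ⊨[ g [ u ← d ] , G ] replace x z φ               ≈⟨ replace-⊨ φ nb ⟩
    M ⊨[ g [ u ← d ] [ x ← (g [ u ← d ]) z ] , G ] φ
      ≡⟨ cong (λ e → M ⊨[ g [ u ← d ] [ x ← e ] , G ] φ) (update-other g d (≢-sym u≢z)) ⟩
    M ⊨[ g [ u ← d ] [ x ← g z ] , G ] φ               ≈⟨ ⊨-cong₁ φ (update-swap g d (g z) u≢x) ⟩
    M ⊨[ g [ x ← g z ] [ u ← d ] , G ] φ               ∎
  replace-⊨ (ex₂ X φ) nb = ∃-cong λ S → replace-⊨ φ nb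

  replace₂-⊨ : ∀ φ → NoBinder₂ z φ →
    (M ⊨[ g , G ] replace₂ x z φ) ⇔ (M ⊨[ g , G [ x ← G z ] ] φ)
  replace₂-⊨ (rel r u v) nb = ⇔-id _
  replace₂-⊨ {z} {G = G} {x} (app X u) nb
    rewrite update-∘ G id x z X = ⇔-id _
  replace₂-⊨ (neg φ) nb = ¬-cong-⇔ (replace₂-⊨ φ nb)
  replace₂-⊨ (conj φ ψ) (nb , nb′) = replace₂-⊨ φ nb ×-⇔ replace₂-⊨ ψ nb′
  replace₂-⊨ (ex u φ) nb = ∃-cong λ d → replace₂-⊨ φ nb
  replace₂-⊨ {z} {g} {G} {x = x} (ex₂ u φ) (u≢z , nb) with u ≟ x
  ... | yes refl rewrite dec-true (u ≟ u) refl = ∃-cong λ S → ⊨-cong₂ φ (sym ∘ update-overwrite G u (G z) S)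
  ... | no u≢x rewrite dec-false (u ≟ x) u≢x = ∃-cong λ S → begin
    M ⊨[ g , G [ u ← S ] ] replace₂ x z φ              ≈⟨ replace₂-⊨ φ nb ⟩
    M ⊨[ g , G [ u ← S ] [ x ← (G [ u ← S ]) z ] ] φ
      ≡⟨ cong (λ e → M ⊨[ g , G [ u ← S ] [ x ← e ] ] φ) (update-other G S (≢-sym u≢z)) ⟩
    M ⊨[ g , G [ u ← S ] [ x ← G z ] ] φ               ≈⟨ ⊨-cong₂ φ (update-swap G S (G z) u≢x) ⟩
    M ⊨[ g , G [ x ← G z ] [ u ← S ] ] φ               ∎

  -- `replace-⊨` does not apply here: `rename z w φ` may have binders ∃w.  No free
  -- z lies below them, which idempotence of `replace` expresses.
  replace-rename-⊨ : w ≢ z → ∀ φ → w ∉ˡ vars φ →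
    (M ⊨[ g , G ] replace z w (rename z w φ)) ⇔ (M ⊨[ g [ z ← g w ] , G ] φ)
  replace-rename-⊨ {g = g} {G} w≢z (rel r u v) w∉ = replace-⊨ {g = g} {G} (rel r u v) tt
  replace-rename-⊨ {g = g} {G} w≢z (app X u) w∉ = replace-⊨ {g = g} {G} (app X u) tt
  replace-rename-⊨ w≢z (neg φ) w∉ = ¬-cong-⇔ (replace-rename-⊨ w≢z φ w∉)
  replace-rename-⊨ w≢z (conj φ ψ) w∉ =
    replace-rename-⊨ w≢z φ (w∉ ∘ ∈-++⁺ˡ) ×-⇔ replace-rename-⊨ w≢z ψ (w∉ ∘ ∈-++⁺ʳ (vars φ))
  replace-rename-⊨ {w} {z} {g} {G} w≢z (ex u φ) w∉ with u ≟ z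
  ... | yes refl rewrite dec-true (u ≟ u) refl | dec-false (w ≟ z) w≢z | replace-idem w≢z (rename z w φ) = ∃-cong λ d → begin
    M ⊨[ g [ w ← d ] , G ] replace z w (rename z w φ)  ≈⟨ replace-rename-⊨ w≢z φ (w∉ ∘ there) ⟩
    M ⊨[ g [ w ← d ] [ z ← (g [ w ← d ]) w ] , G ] φ
      ≈⟨ ⊨-coincide M φ (λ y y∈ → update-via g z d (λ { refl → w∉ (there y∈) })) (λ _ _ → ≐-refl) ⟩
    M ⊨[ g [ z ← d ] , G ] φ                           ≈⟨ ⊨-cong₁ φ (sym ∘ update-overwrite g z (g w) d) ⟩
    M ⊨[ g [ z ← g w ] [ z ← d ] , G ] φ               ∎
  -- The first rewrite settles the test in `rename`; only then does `replace` reach the binder and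
  -- make the same test.
  ... | no u≢z rewrite dec-false (u ≟ z) u≢z | dec-false (u ≟ z) u≢z = ∃-cong λ d → begin
    M ⊨[ g [ u ← d ] , G ] replace z w (rename z w φ)  ≈⟨ replace-rename-⊨ w≢z φ (w∉ ∘ there) ⟩
    M ⊨[ g [ u ← d ] [ z ← (g [ u ← d ]) w ] , G ] φ
      ≡⟨ cong (λ e → M ⊨[ g [ u ← d ] [ z ← e ] , G ] φ) (update-other g d (w∉ ∘ here)) ⟩
    M ⊨[ g [ u ← d ] [ z ← g w ] , G ] φ               ≈⟨ ⊨-cong₁ φ (update-swap g d (g w) u≢z) ⟩
    M ⊨[ g [ z ← g w ] [ u ← d ] , G ] φ               ∎
  replace-rename-⊨ w≢z (ex₂ X φ) w∉ = ∃-cong λ S → replace-rename-⊨ w≢z φ w∉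

  replace₂-rename₂-⊨ : w ≢ z → ∀ φ → w ∉ˡ vars₂ φ →
    (M ⊨[ g , G ] replace₂ z w (rename₂ z w φ)) ⇔ (M ⊨[ g , G [ z ← G w ] ] φ)
  replace₂-rename₂-⊨ w≢z (rel r u v) w∉ = ⇔-id _
  replace₂-rename₂-⊨ {g = g} {G} w≢z (app X u) w∉ = replace₂-⊨ {g = g} {G} (app X u) tt
  replace₂-rename₂-⊨ w≢z (neg φ) w∉ = ¬-cong-⇔ (replace₂-rename₂-⊨ w≢z φ w∉)
  replace₂-rename₂-⊨ w≢z (conj φ ψ) w∉ =
    replace₂-rename₂-⊨ w≢z φ (w∉ ∘ ∈-++⁺ˡ) ×-⇔ replace₂-rename₂-⊨ w≢z ψ (w∉ ∘ ∈-++⁺ʳ (vars₂ φ))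
  replace₂-rename₂-⊨ w≢z (ex x φ) w∉ = ∃-cong λ d → replace₂-rename₂-⊨ w≢z φ w∉
  replace₂-rename₂-⊨ {w} {z} {g} {G} w≢z (ex₂ u φ) w∉ with u ≟ z
  ... | yes refl rewrite dec-true (u ≟ u) refl | dec-false (w ≟ z) w≢z | replace₂-idem w≢z (rename₂ z w φ) = ∃-cong λ S → begin
    M ⊨[ g , G [ w ← S ] ] replace₂ z w (rename₂ z w φ)  ≈⟨ replace₂-rename₂-⊨ w≢z φ (w∉ ∘ there) ⟩
    M ⊨[ g , G [ w ← S ] [ z ← (G [ w ← S ]) w ] ] φ
      ≈⟨ ⊨-coincide M φ (λ _ _ → refl) (λ y y∈ → ≐-reflexive (update-via G z S (λ { refl → w∉ (there y∈) }))) ⟩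
    M ⊨[ g , G [ z ← S ] ] φ                           ≈⟨ ⊨-cong₂ φ (sym ∘ update-overwrite G z (G w) S) ⟩
    M ⊨[ g , G [ z ← G w ] [ z ← S ] ] φ               ∎
  ... | no u≢z rewrite dec-false (u ≟ z) u≢z | dec-false (u ≟ z) u≢z = ∃-cong λ S → begin
    M ⊨[ g , G [ u ← S ] ] replace₂ z w (rename₂ z w φ)  ≈⟨ replace₂-rename₂-⊨ w≢z φ (w∉ ∘ there) ⟩
    M ⊨[ g , G [ u ← S ] [ z ← (G [ u ← S ]) w ] ] φ
      ≡⟨ cong (λ e → M ⊨[ g , G [ u ← S ] [ z ← e ] ] φ) (update-other G S (w∉ ∘ here)) ⟩
    M ⊨[ g , G [ u ← S ] [ z ← G w ] ] φ               ≈⟨ ⊨-cong₂ φ (update-swap G S (G w) u≢z) ⟩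
    M ⊨[ g , G [ z ← G w ] [ u ← S ] ] φ               ∎

  rename-⊨ : w ≢ z → ∀ φ → w ∉ˡ vars φ → (M ⊨[ g , G ] rename z w φ) ⇔ (M ⊨[ g , G ] φ)
  rename-⊨ w≢z (rel r u v) w∉ = ⇔-id _
  rename-⊨ w≢z (app X u) w∉ = ⇔-id _
  rename-⊨ w≢z (neg φ) w∉ = ¬-cong-⇔ (rename-⊨ w≢z φ w∉)
  rename-⊨ w≢z (conj φ ψ) w∉ =
    rename-⊨ w≢z φ (w∉ ∘ ∈-++⁺ˡ) ×-⇔ rename-⊨ w≢z ψ (w∉ ∘ ∈-++⁺ʳ (vars φ))
  rename-⊨ {w} {z} {g} {G} w≢z (ex u φ) w∉ with u ≟ z
  ... | no u≢z rewrite dec-false (u ≟ z) u≢z = ∃-cong λ d → rename-⊨ w≢z φ (w∉ ∘ there)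
  ... | yes refl rewrite dec-true (u ≟ u) refl = ∃-cong λ d → begin
    M ⊨[ g [ w ← d ] , G ] replace z w (rename z w φ)  ≈⟨ replace-rename-⊨ w≢z φ (w∉ ∘ there) ⟩
    M ⊨[ g [ w ← d ] [ z ← (g [ w ← d ]) w ] , G ] φ
      ≈⟨ ⊨-coincide M φ (λ y y∈ → update-via g z d (λ { refl → w∉ (there y∈) })) (λ _ _ → ≐-refl) ⟩
    M ⊨[ g [ z ← d ] , G ] φ                           ∎
  rename-⊨ w≢z (ex₂ X φ) w∉ = ∃-cong λ S → rename-⊨ w≢z φ w∉

  rename₂-⊨ : w ≢ z → ∀ φ → w ∉ˡ vars₂ φ → (M ⊨[ g , G ] rename₂ z w φ) ⇔ (M ⊨[ g , G ] φ)
  rename₂-⊨ w≢z (rel r u v) w∉ = ⇔-id _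
  rename₂-⊨ w≢z (app X u) w∉ = ⇔-id _
  rename₂-⊨ w≢z (neg φ) w∉ = ¬-cong-⇔ (rename₂-⊨ w≢z φ w∉)
  rename₂-⊨ w≢z (conj φ ψ) w∉ =
    rename₂-⊨ w≢z φ (w∉ ∘ ∈-++⁺ˡ) ×-⇔ rename₂-⊨ w≢z ψ (w∉ ∘ ∈-++⁺ʳ (vars₂ φ))
  rename₂-⊨ w≢z (ex x φ) w∉ = ∃-cong λ d → rename₂-⊨ w≢z φ w∉
  rename₂-⊨ {w} {z} {g} {G} w≢z (ex₂ u φ) w∉ with u ≟ z
  ... | no u≢z rewrite dec-false (u ≟ z) u≢z = ∃-cong λ S → rename₂-⊨ w≢z φ (w∉ ∘ there)
  ... | yes refl rewrite dec-true (u ≟ u) refl = ∃-cong λ S → begin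
    M ⊨[ g , G [ w ← S ] ] replace₂ z w (rename₂ z w φ)  ≈⟨ replace₂-rename₂-⊨ w≢z φ (w∉ ∘ there) ⟩
    M ⊨[ g , G [ w ← S ] [ z ← (G [ w ← S ]) w ] ] φ
      ≈⟨ ⊨-coincide M φ (λ _ _ → refl) (λ y y∈ → ≐-reflexive (update-via G z S (λ { refl → w∉ (there y∈) }))) ⟩
    M ⊨[ g , G [ z ← S ] ] φ                           ∎

  -- Renaming to a fresh variable preserves truth and removes every binder `∃z`, which is what
  -- `replace-⊨` needs.
  [←ᵣ]-⊨ : ∀ x z φ → (M ⊨[ g , G ] ([ x ←ᵣ z ] φ)) ⇔ (M ⊨[ g [ x ← g z ] , G ] φ)
  [←ᵣ]-⊨ x z φ =
    rename-⊨ w≢z φ (w∉ ∘ there ∘ there) ⇔-∘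
    replace-⊨ (rename z _ φ) (NoBinder-rename w≢z φ)
    where
    w∉ = fresh-∉ (x ∷ z ∷ vars φ)
    w≢z = w∉ ∘ there ∘ here

  [←ᵣ₂]-⊨ : ∀ X Z φ → (M ⊨[ g , G ] ([ X ←ᵣ₂ Z ] φ)) ⇔ (M ⊨[ g , G [ X ← G Z ] ] φ)
  [←ᵣ₂]-⊨ X Z φ =
    rename₂-⊨ W≢Z φ (W∉ ∘ there ∘ there) ⇔-∘
    replace₂-⊨ (rename₂ Z _ φ) (NoBinder₂-rename₂ W≢Z φ)
    where
    W∉ = fresh-∉ (X ∷ Z ∷ vars₂ φ)
    W≢Z = W∉ ∘ there ∘ here

-- The shallow translation is truth in the structure of named elements

named : {A : Set a} → Interpretation A → (Var → A) → (Var₂ → Pred A a) → Structure A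
named I g G = ⟨ I , Range g , Range₂ G ⟩

module _ {A : Set a} (I : Interpretation A) (g : Var → A) (G : Var₂ → Pred A a) where

  private
    M : Structure A
    M = named I g G

  -- Stated for every accessibility proof, so that the induction hypothesis fits the one that the
  -- recursion supplies for a substituted formula.
  shallow-⊨ : ∀ φ (ac : Acc _<_ (size φ)) → shallow I g G φ ac ⇔ (M ⊨[ g , G ] φ)
  shallow-⊨ (rel r x y) (acc rs) = mk⇔ lift lower
  shallow-⊨ (app X x) (acc rs) = mk⇔ lift lower
  shallow-⊨ (neg φ) (acc rs) = ¬-cong-⇔ (shallow-⊨ φ _)
  shallow-⊨ (conj φ ψ) (acc rs) = shallow-⊨ φ _ ×-⇔ shallow-⊨ ψ _
  shallow-⊨ (ex x φ) (acc rs) = mk⇔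
    (λ (z , t) → g z , (z , refl) , to ([←ᵣ]-⊨ M x z φ) (to (shallow-⊨ ([ x ←ᵣ z ] φ) _) t))
    (λ { (_ , (z , refl) , t) → z , from (shallow-⊨ ([ x ←ᵣ z ] φ) _) (from ([←ᵣ]-⊨ M x z φ) t) })
  shallow-⊨ (ex₂ X φ) (acc rs) = mk⇔
    (λ (Z , t) → G Z , (Z , ≐-refl) , to ([←ᵣ₂]-⊨ M X Z φ) (to (shallow-⊨ ([ X ←ᵣ₂ Z ] φ) _) t))
    (λ (S , (Z , GZ≐S) , t) → Z , from (shallow-⊨ ([ X ←ᵣ₂ Z ] φ) _) (from ([←ᵣ₂]-⊨ M X Z φ)
      -- A member `S` of the family equals some `G Z` only extensionally, so truth is first carried
      -- from `S` to `G Z`.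
      (from (⊨-cong M φ (λ _ → refl) (λ Y → update-cong _≐_ G G X GZ≐S Y ≐-refl)) t)))

-- The Tarski–Vaught test

module _ {A : Set a} (I : Interpretation A) (gg : Var → A) (GG : Var₂ → Pred A a) where

  private
    M : Structure A
    M = named I gg GG

  -- Assignments into the named structure take their values from `gg` and `GG`, so they are
  -- presented by maps `σ`, `τ` on variables; finite parts of these can be coded by numbers.
  record Witnessed : Set (suc a) where
    field
      witness : ∀ ψ x (σ τ : ℕ → ℕ) → full I ⊨[ gg ∘ σ , GG ∘ τ ] ex x ψ →
        ∃[ z ] (full I ⊨[ (gg ∘ σ) [ x ← gg z ] , GG ∘ τ ] ψ)
      witness₂ : ∀ ψ X (σ τ : ℕ → ℕ) → full I ⊨[ gg ∘ σ , GG ∘ τ ] ex₂ X ψ →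
        ∃[ Z ] (full I ⊨[ gg ∘ σ , (GG ∘ τ) [ X ← GG Z ] ] ψ)

  module _ (W : Witnessed) where
    open Witnessed W

    -- Induction on `ψ`. Updating by `gg z` amounts to updating `σ` by `z`, so the hypothesis
    -- applies below a quantifier; witnesses are needed only from right to left.
    named⇔full : ∀ ψ (σ τ : ℕ → ℕ) → (M ⊨[ gg ∘ σ , GG ∘ τ ] ψ) ⇔ (full I ⊨[ gg ∘ σ , GG ∘ τ ] ψ)

    named⇔full-ex : ∀ ψ x z (σ τ : ℕ → ℕ) →
      (M ⊨[ (gg ∘ σ) [ x ← gg z ] , GG ∘ τ ] ψ) ⇔ (full I ⊨[ (gg ∘ σ) [ x ← gg z ] , GG ∘ τ ] ψ)
    named⇔full-ex ψ x z σ τ =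
      ⊨-cong₁ (full I) ψ (update-∘ gg σ x z) ⇔-∘
      (named⇔full ψ (σ [ x ← z ]) τ ⇔-∘
      ⊨-cong₁ M ψ (sym ∘ update-∘ gg σ x z))

    named⇔full-ex₂ : ∀ ψ X Z (σ τ : ℕ → ℕ) →
      (M ⊨[ gg ∘ σ , (GG ∘ τ) [ X ← GG Z ] ] ψ) ⇔ (full I ⊨[ gg ∘ σ , (GG ∘ τ) [ X ← GG Z ] ] ψ)
    named⇔full-ex₂ ψ X Z σ τ =
      ⊨-cong₂ (full I) ψ (update-∘ GG τ X Z) ⇔-∘
      (named⇔full ψ σ (τ [ X ← Z ]) ⇔-∘
      ⊨-cong₂ M ψ (sym ∘ update-∘ GG τ X Z))

    named⇔full (rel r x y) σ τ = ⇔-id _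
    named⇔full (app X x) σ τ = ⇔-id _
    named⇔full (neg φ) σ τ = ¬-cong-⇔ (named⇔full φ σ τ)
    named⇔full (conj φ ψ) σ τ = named⇔full φ σ τ ×-⇔ named⇔full ψ σ τ
    named⇔full (ex x φ) σ τ = mk⇔
      (λ { (_ , (z , refl) , t) → gg z , _ , to (named⇔full-ex φ x z σ τ) t })
      (λ t → let z , t′ = witness φ x σ τ t in
        gg z , (z , refl) , from (named⇔full-ex φ x z σ τ) t′)
    named⇔full (ex₂ X φ) σ τ = mk⇔
      (λ (S , (Z , GGZ≐S) , t) → GG Z , _ , to (named⇔full-ex₂ φ X Z σ τ)
        (from (⊨-cong M φ (λ _ → refl) (λ Y → update-cong _≐_ (GG ∘ τ) (GG ∘ τ) X GGZ≐S Y ≐-refl)) t))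
      (λ t → let Z , t′ = witness₂ φ X σ τ t in
        GG Z , (Z , ≐-refl) , from (named⇔full-ex₂ φ X Z σ τ) t′)

    named-⊆ᴱ-full : M ⊆ᴱ full I
    named-⊆ᴱ-full = _ , _ , λ ψ g G g⊆ G⊆ →
      -- Each value of `g` and `G` lies in the range of `gg` or `GG`; `σ` and `τ` pick a variable
      -- naming it.
      let σ = λ x → proj₁ (g⊆ (x , refl))
          τ = λ X → proj₁ (G⊆ (X , ≐-refl))
          g≗ = λ x → sym (proj₂ (g⊆ (x , refl)))
          G≐ = λ X → ≐-sym (proj₂ (G⊆ (X , ≐-refl)))
      in ⇔-sym (⊨-cong (full I) ψ g≗ G≐) ⇔-∘ (named⇔full ψ σ τ ⇔-∘ ⊨-cong M ψ g≗ G≐)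

-- Enumerations

-- Cantor's walk along the antidiagonals, each from `(0 , s)` to `(s , 0)`.
unpair : ℕ → ℕ × ℕ
unpair zero   = 0 , 0
unpair (1+ n) = next (unpair n)
  where
  next : ℕ × ℕ → ℕ × ℕ
  next (x , zero) = 0 , 1+ x
  next (x , 1+ y) = 1+ x , y

π₁ π₂ : ℕ → ℕ
π₁ = proj₁ ∘ unpair
π₂ = proj₂ ∘ unpair

unpair-sum : ∀ n → π₁ n + π₂ n ≤ n
unpair-sum zero = ≤-refl
unpair-sum (1+ n) with unpair n | unpair-sum n
... | x , zero | p = s≤s (subst (_≤ n) (+-identityʳ x) p)
... | x , 1+ y | p = m≤n⇒m≤1+n (subst (_≤ n) (+-suc x y) p)

-- Follows the walk backwards: the recursion descends on the sum and, within an antidiagonal, on the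
-- first component.
unpair-surjective : ∀ x y → ∃[ n ] (unpair n ≡ (x , y))
unpair-surjective x y = go (x + y) x y refl
  where
  go : ∀ s x y → x + y ≡ s → ∃[ n ] (unpair n ≡ (x , y))
  go s zero zero _ = 0 , refl
  go (1+ s) zero (1+ .s) refl with go s s 0 (+-identityʳ s)
  ... | n , eq = 1+ n , lem
    where
    lem : unpair (1+ n) ≡ (0 , 1+ s)
    lem rewrite eq = refl
  go s (1+ x) y x+y≡s with go s x (1+ y) (trans (+-suc x y) x+y≡s)
  ... | n , eq = 1+ n , lem
    where
    lem : unpair (1+ n) ≡ (1+ x , y)
    lem rewrite eq = refl

abstract

  pair : ℕ → ℕ → ℕ
  pair x y = proj₁ (unpair-surjective x y)

  unpair-pair : ∀ x y → unpair (pair x y) ≡ (x , y)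
  unpair-pair x y = proj₂ (unpair-surjective x y)

π₁-pair : ∀ x y → π₁ (pair x y) ≡ x
π₁-pair x y = cong proj₁ (unpair-pair x y)

π₂-pair : ∀ x y → π₂ (pair x y) ≡ y
π₂-pair x y = cong proj₂ (unpair-pair x y)

≤-pair : ∀ x y → x ≤ pair x y
≤-pair x y = subst (_≤ pair x y) (π₁-pair x y) (≤-trans (m≤m+n _ _) (unpair-sum (pair x y)))

-- Numbers as infinite sequences, with head `π₁` and tail `π₂`

digit : ℕ → ℕ → ℕ
digit c zero   = π₁ c
digit c (1+ i) = digit (π₂ c) i

digit-surjective : ∀ n (σ : ℕ → ℕ) → ∃[ c ] (∀ i → i < n → digit c i ≡ σ i)
digit-surjective zero σ = 0 , λ _ ()
digit-surjective (1+ n) σ with digit-surjective n (σ ∘ 1+)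
... | c , digits = pair (σ 0) c , λ where
  zero   _   → π₁-pair (σ 0) c
  (1+ i) i<n → trans (cong (λ d → digit d i) (π₂-pair (σ 0) c)) (digits i (s≤s⁻¹ i<n))

build : (ℕ → Formula) → ℕ → ℕ × ℕ → Formula
build dec 0 (r , d) = rel r (π₁ d) (π₂ d)
build dec 1 (X , x) = app X x
build dec 2 (_ , d) = neg (dec d)
build dec 3 (d , e) = conj (dec d) (dec e)
build dec 4 (x , d) = ex x (dec d)
-- Every tag from 5 on is read as `ex₂`, which makes decoding total.
build dec _ (X , d) = ex₂ X (dec d)

-- The fuel bounds the depth of the decoded formula, since parts of a code are not structurally
-- smaller; `rel 0 0 0` is the value when it runs out.
decode : (fuel : ℕ) → ℕ → Formula
decode zero   c = rel 0 0 0
decode (1+ k) c = build (decode k) (π₁ c) (unpair (π₂ c))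

node : ℕ → ℕ → ℕ → ℕ
node t x y = pair t (pair x y)

code : Formula → ℕ
code (rel r x y) = node 0 r (pair x y)
code (app X x)   = node 1 X x
code (neg φ)     = node 2 0 (code φ)
code (conj φ ψ)  = node 3 (code φ) (code ψ)
code (ex x φ)    = node 4 x (code φ)
code (ex₂ X φ)   = node 5 X (code φ)

decode-node : ∀ k t x y → decode (1+ k) (node t x y) ≡ build (decode k) t (x , y)
decode-node k t x y rewrite unpair-pair t (pair x y) | unpair-pair x y = refl

decode-code : ∀ φ k → size φ ≤ k → decode k (code φ) ≡ φ
decode-code (rel r x y) (1+ k) _ rewrite decode-node k 0 r (pair x y) | unpair-pair x y = refl
decode-code (app X x) (1+ k) _ = decode-node k 1 X x
decode-code (neg φ) (1+ k) (s≤s φ≤k) =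
  trans (decode-node k 2 0 (code φ)) (cong neg (decode-code φ k φ≤k))
decode-code (conj φ ψ) (1+ k) (s≤s φ+ψ≤k) =
  trans (decode-node k 3 (code φ) (code ψ))
    (cong₂ conj (decode-code φ k (m+n≤o⇒m≤o (size φ) φ+ψ≤k))
                (decode-code ψ k (m+n≤o⇒n≤o (size φ) φ+ψ≤k)))
decode-code (ex x φ) (1+ k) (s≤s φ≤k) =
  trans (decode-node k 4 x (code φ)) (cong (ex x) (decode-code φ k φ≤k))
decode-code (ex₂ X φ) (1+ k) (s≤s φ≤k) =
  trans (decode-node k 5 X (code φ)) (cong (ex₂ X) (decode-code φ k φ≤k))

-- A request is a formula with two renamings of its variables.  The first
-- component of k is ignored, so that every request recurs at arbitrarily late k.
requestφ : ℕ → Formula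
requestφ k = decode (digit k 1) (digit k 2)

requestσ requestτ : ℕ → ℕ → ℕ
requestσ k = digit (digit k 3)
requestτ k = digit (digit k 4)

-- A number can prescribe only finitely many values, so agreement with `σ` and `τ` is confined to
-- the variables of `φ`.
record Request (φ : Formula) (σ τ : ℕ → ℕ) (b k : ℕ) : Set where
  field
    late   : b ≤ k
    is-φ   : requestφ k ≡ φ
    is-σ   : ∀ x → x ∈ˡ vars φ → requestσ k x ≡ σ x
    is-τ   : ∀ X → X ∈ˡ vars₂ φ → requestτ k X ≡ τ X

request : ∀ φ (σ τ : ℕ → ℕ) b → ∃ (Request φ σ τ b)
request φ σ τ b = k , record
  { late = ≤-pair b _
  ; is-φ = trans (cong₂ decode d₁ d₂) (decode-code φ (size φ) ≤-refl)
  ; is-σ = λ x x∈ → trans (cong (λ c → digit c x) d₃)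
      (proj₂ σ-code x (s≤s (∈⇒≤max _ x∈)))
  ; is-τ = λ X X∈ → trans (cong (λ c → digit c X) d₄)
      (proj₂ τ-code X (s≤s (∈⇒≤max _ X∈)))
  }
  where
  σ-code = digit-surjective (1+ (max 0 (vars φ))) σ
  τ-code = digit-surjective (1+ (max 0 (vars₂ φ))) τ

  -- Digit 0 of `k` is `b`, which forces `b ≤ k`; digits 1 to 4 are the fuel and the codes of `φ`,
  -- `σ` and `τ`.
  k₄ k₃ k₂ k₁ k : ℕ
  k₄ = pair (proj₁ τ-code) 0
  k₃ = pair (proj₁ σ-code) k₄
  k₂ = pair (code φ) k₃
  k₁ = pair (size φ) k₂
  k  = pair b k₁

  d₁ : digit k 1 ≡ size φ
  d₁ rewrite unpair-pair b k₁ = π₁-pair (size φ) k₂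

  d₂ : digit k 2 ≡ code φ
  d₂ rewrite unpair-pair b k₁ | unpair-pair (size φ) k₂ = π₁-pair (code φ) k₃

  d₃ : digit k 3 ≡ proj₁ σ-code
  d₃ rewrite unpair-pair b k₁ | unpair-pair (size φ) k₂ | unpair-pair (code φ) k₃ =
    π₁-pair (proj₁ σ-code) k₄

  d₄ : digit k 4 ≡ proj₁ τ-code
  d₄ rewrite unpair-pair b k₁ | unpair-pair (size φ) k₂ | unpair-pair (code φ) k₃
    | unpair-pair (proj₁ σ-code) k₄ = π₁-pair (proj₁ τ-code) 0

-- Löwenheim–Skolem

-- In the sequences below, stage `1+ i` is followed only by changes at variables from `1+ i + n` on,
-- so the value at `i` is final there.
limit : (ℕ → ℕ → A) → ℕ → A
limit s i = s (1+ i) i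

module _ {A : Set a} (n : ℕ) (s : ℕ → ℕ → A) (v : ℕ → A)
         (step : ∀ k → s (1+ k) ≡ s k [ k + n ← v k ]) where

  stage-stable : ∀ d j {i} → i < j + n → s (d + j) i ≡ s j i
  stage-stable zero j i<j+n = refl
  stage-stable (1+ d) j {i} i<j+n = begin
    s (1+ (d + j)) i                          ≡⟨ cong (λ h → h i) (step (d + j)) ⟩
    (s (d + j) [ d + j + n ← v (d + j) ]) i   ≡⟨ update-other (s (d + j)) (v (d + j)) (<⇒≢ i<d+j+n) ⟩
    s (d + j) i                               ≡⟨ stage-stable d j i<j+n ⟩
    s j i                                     ∎
    where
    open ≡-Reasoning
    i<d+j+n : i < d + j + n
    i<d+j+n = <-≤-trans i<j+n (+-monoˡ-≤ n (m≤n+m j d))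

  -- Either of the stages `j` and `1+ i` may come first; both agree at `i` with the later stage
  -- numbered by their sum.
  limit-stage : ∀ j {i} → i < j + n → limit s i ≡ s j i
  limit-stage j {i} i<j+n = begin
    s (1+ i) i        ≡⟨ stage-stable j (1+ i) (m≤m+n (1+ i) n) ⟨
    s (j + 1+ i) i    ≡⟨ cong (λ k → s k i) (+-comm j (1+ i)) ⟩
    s (1+ i + j) i    ≡⟨ stage-stable (1+ i) j i<j+n ⟩
    s j i             ∎
    where open ≡-Reasoning

  limit-new : ∀ k → limit s (k + n) ≡ v k
  limit-new k = begin
    limit s (k + n)                    ≡⟨ limit-stage (1+ k) ≤-refl ⟩
    s (1+ k) (k + n)                   ≡⟨ cong (λ h → h (k + n)) (step k) ⟩
    (s k [ k + n ← v k ]) (k + n)      ≡⟨ update-same (s k) (k + n) (v k) ⟩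
    v k                                ∎
    where open ≡-Reasoning

choose : {P : Pred A ℓ} → Dec (∃ P) → A → A
choose (yes (x , _)) _ = x
choose (no _)        d = d

choose-spec : {P : Pred A ℓ} (P? : Dec (∃ P)) {d : A} → ∃ P → P (choose P? d)
choose-spec (yes (_ , px)) _ = px
choose-spec (no ∄P) ∃P = contradiction ∃P ∄P

module LöwenheimSkolem (em : ExcludedMiddle (suc a)) {A : Set a} (I : Interpretation A)
  (g : Var → A) (G : Var₂ → Pred A a) (n : ℕ) where

  -- A Skolem function for an outermost `ex`. Truth of `ex x φ` is itself an existential, so
  -- excluded middle yields a witness or else the default `h 0`.
  skolem : Formula → (Var → A) → (Var₂ → Pred A a) → A
  skolem (ex x φ) h H = choose (em {full I ⊨[ h , H ] ex x φ}) (h 0)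
  skolem _        h H = h 0

  skolem₂ : Formula → (Var → A) → (Var₂ → Pred A a) → Pred A a
  skolem₂ (ex₂ X φ) h H = choose (em {full I ⊨[ h , H ] ex₂ X φ}) (H 0)
  skolem₂ _         h H = H 0

  -- Each stage treats one request and assigns variable `k + n` in both namespaces, which keeps a
  -- single bound for both; a namespace that the request does not concern gets a default.
  stage : ℕ → (Var → A) × (Var₂ → Pred A a)
  new  : ℕ → A
  new₂ : ℕ → Pred A a

  stage zero   = g , G
  stage (1+ k) = proj₁ (stage k) [ k + n ← new k ] , proj₂ (stage k) [ k + n ← new₂ k ]

  new  k = skolem  (requestφ k) (proj₁ (stage k) ∘ requestσ k) (proj₂ (stage k) ∘ requestτ k)
  new₂ k = skolem₂ (requestφ k) (proj₁ (stage k) ∘ requestσ k) (proj₂ (stage k) ∘ requestτ k)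

  gg : Var → A
  gg = limit (proj₁ ∘ stage)

  GG : Var₂ → Pred A a
  GG = limit (proj₂ ∘ stage)

  gg-stage : ∀ k {i} → i < k + n → gg i ≡ proj₁ (stage k) i
  gg-stage = limit-stage n (proj₁ ∘ stage) new (λ _ → refl)

  GG-stage : ∀ k {i} → i < k + n → GG i ≡ proj₂ (stage k) i
  GG-stage = limit-stage n (proj₂ ∘ stage) new₂ (λ _ → refl)

  module Served (φ : Formula) (σ τ : ℕ → ℕ) where

    -- Lies above all `σ x` and `τ X` for variables of `φ`, so at a stage `k` not below it these
    -- already have their final values.
    bound : ℕ
    bound = 1+ (max 0 (map σ (vars φ)) + max 0 (map τ (vars₂ φ)))

    k : ℕ
    k = proj₁ (request φ σ τ bound)

    open Request (proj₂ (request φ σ τ bound))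

    h : Var → A
    h = proj₁ (stage k) ∘ requestσ k

    H : Var₂ → Pred A a
    H = proj₂ (stage k) ∘ requestτ k

    h≡ : ∀ x → x ∈ˡ vars φ → h x ≡ gg (σ x)
    h≡ x x∈ = trans (cong (proj₁ (stage k)) (is-σ x x∈)) (sym (gg-stage k σx<))
      where
      σx< : σ x < k + n
      σx< = ≤-trans (s≤s (≤-trans (∈⇒≤max _ (∈-map⁺ σ x∈)) (m≤m+n _ _)))
                    (≤-trans late (m≤m+n k n))

    H≐ : ∀ X → X ∈ˡ vars₂ φ → H X ≐ GG (τ X)
    H≐ X X∈ = ≐-reflexive (trans (cong (proj₂ (stage k)) (is-τ X X∈)) (sym (GG-stage k τX<)))
      where
      τX< : τ X < k + n
      τX< = ≤-trans (s≤s (≤-trans (∈⇒≤max _ (∈-map⁺ τ X∈)) (m≤n+m _ _)))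
                    (≤-trans late (m≤m+n k n))

    served : (full I ⊨[ h , H ] φ) ⇔ (full I ⊨[ gg ∘ σ , GG ∘ τ ] φ)
    served = ⊨-coincide (full I) φ h≡ H≐

    gg-new : gg (k + n) ≡ skolem φ h H
    gg-new = trans (limit-new n (proj₁ ∘ stage) new (λ _ → refl) k)
                   (cong (λ ψ → skolem ψ h H) is-φ)

    GG-new : GG (k + n) ≡ skolem₂ φ h H
    GG-new = trans (limit-new n (proj₂ ∘ stage) new₂ (λ _ → refl) k)
                   (cong (λ ψ → skolem₂ ψ h H) is-φ)

  -- An existential statement true in the limit was already true at the stage serving it, so the
  -- choice made there found a genuine witness; coincidence carries this witness to the limit.
  witnessed : Witnessed I gg GG
  witnessed = record
    { witness = λ ψ x σ τ t → let open Served (ex x ψ) σ τ in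
        k + n ,
        to (⊨-coincide (full I) ψ
             (λ y y∈ → update-cong _≡_ h (gg ∘ σ) x (sym gg-new) y (h≡ y (there y∈))) H≐)
           (proj₂ (choose-spec em (from served t)))
    ; witness₂ = λ ψ X σ τ t → let open Served (ex₂ X ψ) σ τ in
        k + n ,
        to (⊨-coincide (full I) ψ h≡
             (λ Y Y∈ → update-cong _≐_ H (GG ∘ τ) X (≐-reflexive (sym GG-new)) Y (H≐ Y (there Y∈))))
           (proj₂ (choose-spec em (from served t)))
    }

-- Equivalence of standard validity and validity of the translation

mainTheorem3 : ∀ {a} → ExcludedMiddle (suc a) →
    (U : Set a) → U → (φ : Formula) →
    Valid U φ ⇔
    ((II : Interpretation U) (gg : Var → U) (GG : Var₂ → Pred U a) →
    ⟨ II , Range gg , Range₂ GG ⟩ ⊆ᴱ full II →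
    ⦅ φ ⦆ II gg GG)
mainTheorem3 em U _ φ = mk⇔
  (λ valid I g G (_ , _ , elementary) →
    -- The assignments `g` and `G` trivially take values in their own ranges.
    from (shallow-⊨ I g G φ _) (from (elementary φ g G id id) (valid I g G)))
  (λ shallow-valid I g G →
    -- Exceeds every variable of `φ` of either kind, so none of them is overwritten after stage 0.
    let n = 1+ (max 0 (vars φ) + max 0 (vars₂ φ))
        open LöwenheimSkolem em I g G n
        sub = named-⊆ᴱ-full I gg GG witnessed
        _ , _ , elementary = sub
    in to (⊨-coincide (full I) φ
            (λ x x∈ → gg-stage 0 (s≤s (≤-trans (∈⇒≤max _ x∈) (m≤m+n _ _))))
            (λ X X∈ → ≐-reflexive (GG-stage 0 (s≤s (≤-trans (∈⇒≤max _ X∈) (m≤n+m _ _))))))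
          (to (elementary φ gg GG id id)
            (to (shallow-⊨ I gg GG φ _) (shallow-valid I gg GG sub))))
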